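{- Let $(G_m)_{m\in\mathbb{Z}}$ be a generalized Fibonacci sequence and let $n\ge 0$ be an integer. Then $$\begin{aligned} \sum_{k=0}^n k^2 G_k G_{n-k} = \frac{1}{150} \Big\{ & \left[ 3n ( 10n^2+25n+13 ) G_0 - (n+1) ( 10n^2+5n-12 ) G_1 \right] G_n \\ & - \left[ (n-1) (10n^2-5n-12) G_0 - 2n ( 10n^2-7 ) G_1 \right] G_{n+1} \Big\}. \end{aligned}$$
   Context: A generalized Fibonacci sequence is a sequence $(G_m)_{m\in\mathbb{Z}}$ of complex numbers with $G_{m+2}=G_{m+1}+G_m$ for all integers $m$ (with arbitrary seed $G_0,G_1$). -}

module Defs where

open import Algebra.Bundles using (CommutativeRing)
open import Data.Integer.Base as ℤ using (ℤ; +_)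
open import Data.Nat.Base as ℕ using (ℕ)
import Data.Nat.Properties as ℕ
open import Data.Product.Base using (∃-syntax; _×_; _,_)
open import Data.Rational.Base as ℚ using (ℚ; 0ℚ; 1ℚ; ½; ∣_∣; Positive)
import Data.Rational.Properties as ℚ
open import Level using (0ℓ)
open import Relation.Binary.PropositionalEquality
  using (_≡_; refl; sym; trans; cong; cong₂; subst; module ≡-Reasoning)

------------------------------------------------------------------------
-- Identities in commutative rings and estimates in ℚ

private
  module Laws {c ℓ} (R : CommutativeRing c ℓ) where
    open CommutativeRing R renaming (refl to ≈-refl; sym to ≈-sym; trans to ≈-trans)
    open import Algebra.Properties.Ring ring
    open import Algebra.Solver.Ring.NaturalCoefficients.Default commutativeSemiring
    open import Relation.Binary.Reasoning.Setoid setoid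

    -- The solver is for semirings, so negation is passed to it as
    -- multiplication by an atom standing for -1.
    m : Carrier
    m = - 1#

    neg : ∀ x → - x ≈ m * x
    neg x = ≈-sym (-1*x≈-x x)

    neg-diff : ∀ a b → - a - - b ≈ - (a - b)
    neg-diff a b = -‿+-comm a (- b)

    neg-swap : ∀ a b → - (a - b) ≈ b - a
    neg-swap a b = begin
      - (a - b)    ≈⟨ -‿+-comm a (- b) ⟨
      - a - - b    ≈⟨ +-congˡ (-‿involutive b) ⟩
      - a + b      ≈⟨ +-comm (- a) b ⟩
      b - a        ∎

    back : ∀ a b → (a - b) + b ≈ a
    back a b = begin
      (a - b) + b    ≈⟨ +-assoc a (- b) b ⟩
      a + (- b + b)  ≈⟨ +-congˡ (-‿inverseˡ b) ⟩
      a + 0#         ≈⟨ +-identityʳ a ⟩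
      a              ∎

    telescope : ∀ a b c → (a - b) + (b - c) ≈ a - c
    telescope a b c = begin
      (a - b) + (b - c)    ≈⟨ +-assoc (a - b) b (- c) ⟨
      ((a - b) + b) - c    ≈⟨ +-congʳ (back a b) ⟩
      a - c                ∎

    diff-sum : ∀ a b c d → (a - c) + (b - d) ≈ (a + b) - (c + d)
    diff-sum a b c d = begin
      (a - c) + (b - d)          ≈⟨ solve 4 (λ a b c′ d′ →
                                      (a :+ c′) :+ (b :+ d′) := (a :+ b) :+ (c′ :+ d′))
                                      ≈-refl a b (- c) (- d) ⟩
      (a + b) + (- c - d)        ≈⟨ +-congˡ (-‿+-comm c d) ⟩
      (a + b) - (c + d)          ∎

    diff-prod : ∀ a b c d → a * (b - d) + d * (a - c) ≈ a * b - c * d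
    diff-prod a b c d = begin
      a * (b - d) + d * (a - c)
        ≈⟨ +-cong (x[y-z]≈xy-xz a b d) (x[y-z]≈xy-xz d a c) ⟩
      (a * b - a * d) + (d * a - d * c)
        ≈⟨ +-congˡ (+-cong (*-comm d a) (-‿cong (*-comm d c))) ⟩
      (a * b - a * d) + (a * d - c * d)
        ≈⟨ telescope (a * b) (a * d) (c * d) ⟩
      a * b - c * d ∎

    comm-re : ∀ a b c d → a * c - b * d ≈ c * a - d * b
    comm-re a b c d = +-cong (*-comm a c) (-‿cong (*-comm b d))

    comm-im : ∀ a b c d → a * d + b * c ≈ c * b + d * a
    comm-im = solve 4 (λ a b c d → a :* d :+ b :* c := c :* b :+ d :* a) ≈-refl

    assoc-re : ∀ a b c d e f →
      (a * c - b * d) * e - (a * d + b * c) * f ≈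
      a * (c * e - d * f) - b * (c * f + d * e)
    assoc-re a b c d e f = begin
      (a * c - b * d) * e - (a * d + b * c) * f
        ≈⟨ +-cong (*-congʳ (+-congˡ (neg (b * d)))) (neg ((a * d + b * c) * f)) ⟩
      (a * c + m * (b * d)) * e + m * ((a * d + b * c) * f)
        ≈⟨ solve 7 (λ m a b c d e f →
             (a :* c :+ m :* (b :* d)) :* e :+ m :* ((a :* d :+ b :* c) :* f) :=
             a :* (c :* e :+ m :* (d :* f)) :+ m :* (b :* (c :* f :+ d :* e)))
             ≈-refl m a b c d e f ⟩
      a * (c * e + m * (d * f)) + m * (b * (c * f + d * e))
        ≈⟨ +-cong (*-congˡ (+-congˡ (neg (d * f)))) (neg (b * (c * f + d * e))) ⟨
      a * (c * e - d * f) - b * (c * f + d * e) ∎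

    assoc-im : ∀ a b c d e f →
      (a * c - b * d) * f + (a * d + b * c) * e ≈
      a * (c * f + d * e) + b * (c * e - d * f)
    assoc-im a b c d e f = begin
      (a * c - b * d) * f + (a * d + b * c) * e
        ≈⟨ +-congʳ (*-congʳ (+-congˡ (neg (b * d)))) ⟩
      (a * c + m * (b * d)) * f + (a * d + b * c) * e
        ≈⟨ solve 7 (λ m a b c d e f →
             (a :* c :+ m :* (b :* d)) :* f :+ (a :* d :+ b :* c) :* e :=
             a :* (c :* f :+ d :* e) :+ b :* (c :* e :+ m :* (d :* f)))
             ≈-refl m a b c d e f ⟩
      a * (c * f + d * e) + b * (c * e + m * (d * f))
        ≈⟨ +-congˡ (*-congˡ (+-congˡ (neg (d * f)))) ⟨
      a * (c * f + d * e) + b * (c * e - d * f) ∎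

    distrib-re : ∀ a b c d e f →
      a * (c + e) - b * (d + f) ≈ (a * c - b * d) + (a * e - b * f)
    distrib-re a b c d e f = begin
      a * (c + e) - b * (d + f)
        ≈⟨ +-cong (distribˡ a c e) (-‿cong (distribˡ b d f)) ⟩
      (a * c + a * e) - (b * d + b * f)
        ≈⟨ diff-sum (a * c) (a * e) (b * d) (b * f) ⟨
      (a * c - b * d) + (a * e - b * f) ∎

    distrib-im : ∀ a b c d e f →
      a * (d + f) + b * (c + e) ≈ (a * d + b * c) + (a * f + b * e)
    distrib-im = solve 6 (λ a b c d e f →
      a :* (d :+ f) :+ b :* (c :+ e) := (a :* d :+ b :* c) :+ (a :* f :+ b :* e)) ≈-refl

    identity-re : ∀ a b → 1# * a - 0# * b ≈ a
    identity-re a b = begin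
      1# * a - 0# * b  ≈⟨ +-cong (*-identityˡ a) (-‿cong (zeroˡ b)) ⟩
      a - 0#           ≈⟨ +-congˡ -0#≈0# ⟩
      a + 0#           ≈⟨ +-identityʳ a ⟩
      a                ∎

    identity-im : ∀ a b → 1# * b + 0# * a ≈ b
    identity-im a b = begin
      1# * b + 0# * a  ≈⟨ +-cong (*-identityˡ b) (zeroˡ a) ⟩
      b + 0#           ≈⟨ +-identityʳ b ⟩
      b                ∎

  module ℚ-Laws = Laws ℚ.+-*-commutativeRing

  halves : ∀ ε → ½ ℚ.* ε ℚ.+ ½ ℚ.* ε ≡ ε
  halves ε = trans (sym (ℚ.*-distribʳ-+ ε ½ ½)) (ℚ.*-identityˡ ε)

  half-pos : ∀ ε → Positive ε → Positive (½ ℚ.* ε)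
  half-pos ε p = ℚ.pos*pos⇒pos ½ ε {{p}}

  self-diff : ∀ a → ∣ a ℚ.- a ∣ ≡ 0ℚ
  self-diff a = cong ∣_∣ (ℚ.+-inverseʳ a)

  diff-sym : ∀ a b → ∣ a ℚ.- b ∣ ≡ ∣ b ℚ.- a ∣
  diff-sym a b = trans (sym (ℚ.∣-p∣≡∣p∣ (a ℚ.- b)))
    (cong ∣_∣ (ℚ-Laws.neg-swap a b))

  sum<ε : ∀ u v ε → ∣ u ∣ ℚ.< ½ ℚ.* ε → ∣ v ∣ ℚ.< ½ ℚ.* ε → ∣ u ℚ.+ v ∣ ℚ.< ε
  sum<ε u v ε p q = subst (∣ u ℚ.+ v ∣ ℚ.<_) (halves ε)
    (ℚ.≤-<-trans (ℚ.∣p+q∣≤∣p∣+∣q∣ u v) (ℚ.+-mono-< p q))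

  tri<ε : ∀ a b c ε → ∣ a ℚ.- b ∣ ℚ.< ½ ℚ.* ε → ∣ b ℚ.- c ∣ ℚ.< ½ ℚ.* ε →
          ∣ a ℚ.- c ∣ ℚ.< ε
  tri<ε a b c ε p q = subst (λ t → ∣ t ∣ ℚ.< ε) (ℚ-Laws.telescope a b c)
    (sum<ε (a ℚ.- b) (b ℚ.- c) ε p q)

  add<ε : ∀ a b c d ε → ∣ a ℚ.- c ∣ ℚ.< ½ ℚ.* ε → ∣ b ℚ.- d ∣ ℚ.< ½ ℚ.* ε →
          ∣ (a ℚ.+ b) ℚ.- (c ℚ.+ d) ∣ ℚ.< ε
  add<ε a b c d ε p q = subst (λ t → ∣ t ∣ ℚ.< ε) (ℚ-Laws.diff-sum a b c d)
    (sum<ε (a ℚ.- c) (b ℚ.- d) ε p q)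

  neg-diff : ∀ a b → ∣ ℚ.- a ℚ.- ℚ.- b ∣ ≡ ∣ a ℚ.- b ∣
  neg-diff a b = trans (cong ∣_∣ (sym (ℚ.neg-distrib-+ a (ℚ.- b))))
                       (ℚ.∣-p∣≡∣p∣ (a ℚ.- b))

  -- The δ with A * δ = ½ * ε.
  scale : (A : ℚ) → Positive A → ℚ → ℚ
  scale A p ε = (ℚ.1/ A) {{ℚ.pos⇒nonZero A {{p}}}} ℚ.* (½ ℚ.* ε)

  scale-pos : ∀ A p ε → Positive ε → Positive (scale A p ε)
  scale-pos A p ε q = ℚ.pos*pos⇒pos i {{ℚ.1/pos⇒pos A {{p}}}} (½ ℚ.* ε) {{half-pos ε q}}
    where i = (ℚ.1/ A) {{ℚ.pos⇒nonZero A {{p}}}}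

  scale-eq : ∀ A p ε → A ℚ.* scale A p ε ≡ ½ ℚ.* ε
  scale-eq A p ε = begin
    A ℚ.* (i ℚ.* (½ ℚ.* ε))  ≡⟨ ℚ.*-assoc A i (½ ℚ.* ε) ⟨
    A ℚ.* i ℚ.* (½ ℚ.* ε)    ≡⟨ cong (ℚ._* (½ ℚ.* ε)) (ℚ.*-inverseʳ A {{nz}}) ⟩
    1ℚ ℚ.* (½ ℚ.* ε)         ≡⟨ ℚ.*-identityˡ (½ ℚ.* ε) ⟩
    ½ ℚ.* ε                  ∎
    where
    open ≡-Reasoning
    nz = ℚ.pos⇒nonZero A {{p}}
    i  = (ℚ.1/ A) {{nz}}

  prod<ε : ∀ u v A p ε → ∣ u ∣ ℚ.< A → ∣ v ∣ ℚ.< scale A p ε → ∣ u ℚ.* v ∣ ℚ.< ½ ℚ.* ε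
  prod<ε u v A p ε u<A v<δ = begin-strict
    ∣ u ℚ.* v ∣          ≡⟨ ℚ.∣p*q∣≡∣p∣*∣q∣ u v ⟩
    ∣ u ∣ ℚ.* ∣ v ∣      ≤⟨ ℚ.*-monoʳ-≤-nonNeg ∣ v ∣ {{ℚ.∣-∣-nonNeg v}} (ℚ.<⇒≤ u<A) ⟩
    A ℚ.* ∣ v ∣          <⟨ ℚ.*-monoʳ-<-pos A {{p}} v<δ ⟩
    A ℚ.* scale A p ε    ≡⟨ scale-eq A p ε ⟩
    ½ ℚ.* ε              ∎
    where open ℚ.≤-Reasoning

  mul<ε : ∀ a b c d A p B q ε → ∣ a ∣ ℚ.< A → ∣ d ∣ ℚ.< B →
          ∣ b ℚ.- d ∣ ℚ.< scale A p ε → ∣ a ℚ.- c ∣ ℚ.< scale B q ε →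
          ∣ a ℚ.* b ℚ.- c ℚ.* d ∣ ℚ.< ε
  mul<ε a b c d A p B q ε a<A d<B bd ac = subst (λ t → ∣ t ∣ ℚ.< ε) (ℚ-Laws.diff-prod a b c d)
    (sum<ε (a ℚ.* (b ℚ.- d)) (d ℚ.* (a ℚ.- c)) ε
      (prod<ε a (b ℚ.- d) A p ε a<A bd) (prod<ε d (a ℚ.- c) B q ε d<B ac))

------------------------------------------------------------------------
-- Real numbers: Cauchy sequences of rationals, with sequences whose
-- difference tends to zero regarded as equal.  As there are no quotient
-- types, this equality is the setoid relation _≈ʳ_.

IsCauchy : (ℕ → ℚ) → Set
IsCauchy x = ∀ ε → Positive ε →
  ∃[ N ] (∀ m n → N ℕ.≤ m → N ℕ.≤ n → ∣ x m ℚ.- x n ∣ ℚ.< ε)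

record ℝ : Set where
  -- Together with the copattern definitions below, this keeps type
  -- checking from comparing proofs of the Cauchy property.
  no-eta-equality
  field
    seq    : ℕ → ℚ
    cauchy : IsCauchy seq

open ℝ public

infix 4 _≈ʳ_

record _≈ʳ_ (x y : ℝ) : Set where
  constructor mk≈ʳ
  field
    close : ∀ ε → Positive ε →
      ∃[ N ] (∀ n → N ℕ.≤ n → ∣ seq x n ℚ.- seq y n ∣ ℚ.< ε)

open _≈ʳ_ public

private
  ⊔ˡ : ∀ {M N n} → M ℕ.⊔ N ℕ.≤ n → M ℕ.≤ n
  ⊔ˡ {M} {N} = ℕ.m⊔n≤o⇒m≤o M N

  ⊔ʳ : ∀ {M N n} → M ℕ.⊔ N ℕ.≤ n → N ℕ.≤ n
  ⊔ʳ {M} {N} = ℕ.m⊔n≤o⇒n≤o M N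

  bounded : ∀ x → IsCauchy x →
    ∃[ A ] ∃[ N ] (Positive A × (∀ n → N ℕ.≤ n → ∣ x n ∣ ℚ.< A))
  bounded x c with c 1ℚ _
  ... | N , h = A , N , pos , below
    where
    A = 1ℚ ℚ.+ ∣ x N ∣
    pos : Positive A
    pos = ℚ.pos+nonNeg⇒pos 1ℚ ∣ x N ∣ {{ℚ.∣-∣-nonNeg (x N)}}
    below : ∀ n → N ℕ.≤ n → ∣ x n ∣ ℚ.< A
    below n N≤n = begin-strict
      ∣ x n ∣                        ≡⟨ cong ∣_∣ (ℚ-Laws.back (x n) (x N)) ⟨
      ∣ (x n ℚ.- x N) ℚ.+ x N ∣      ≤⟨ ℚ.∣p+q∣≤∣p∣+∣q∣ (x n ℚ.- x N) (x N) ⟩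
      ∣ x n ℚ.- x N ∣ ℚ.+ ∣ x N ∣    <⟨ ℚ.+-monoˡ-< ∣ x N ∣ (h n N N≤n ℕ.≤-refl) ⟩
      1ℚ ℚ.+ ∣ x N ∣                 ∎
      where open ℚ.≤-Reasoning

  const-cauchy : ∀ q → IsCauchy (λ _ → q)
  const-cauchy q ε p = 0 , λ _ _ _ _ →
    subst (ℚ._< ε) (sym (self-diff q)) (ℚ.positive⁻¹ ε {{p}})

  add-cauchy : ∀ x y → IsCauchy x → IsCauchy y → IsCauchy (λ n → x n ℚ.+ y n)
  add-cauchy x y c d ε p with c (½ ℚ.* ε) (half-pos ε p) | d (½ ℚ.* ε) (half-pos ε p)
  ... | M , f | N , g = M ℕ.⊔ N , λ m n hm hn →
    add<ε (x m) (y m) (x n) (y n) ε (f m n (⊔ˡ hm) (⊔ˡ hn)) (g m n (⊔ʳ {M} hm) (⊔ʳ {M} hn))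

  neg-cauchy : ∀ x → IsCauchy x → IsCauchy (λ n → ℚ.- x n)
  neg-cauchy x c ε p with c ε p
  ... | N , f = N , λ m n hm hn →
    subst (ℚ._< ε) (sym (neg-diff (x m) (x n))) (f m n hm hn)

  mul-cauchy : ∀ x y → IsCauchy x → IsCauchy y → IsCauchy (λ n → x n ℚ.* y n)
  mul-cauchy x y c d ε p =
    let A , K , A>0 , f = bounded x c
        B , L , B>0 , g = bounded y d
        M , h = d (scale A A>0 ε) (scale-pos A A>0 ε p)
        N , k = c (scale B B>0 ε) (scale-pos B B>0 ε p)
    in (K ℕ.⊔ L) ℕ.⊔ (M ℕ.⊔ N) , λ m n hm hn →
    let m₁ = ⊔ˡ {K ℕ.⊔ L} {M ℕ.⊔ N} hm
        m₂ = ⊔ʳ {K ℕ.⊔ L} {M ℕ.⊔ N} hm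
        n₁ = ⊔ˡ {K ℕ.⊔ L} {M ℕ.⊔ N} hn
        n₂ = ⊔ʳ {K ℕ.⊔ L} {M ℕ.⊔ N} hn
    in mul<ε (x m) (y m) (x n) (y n) A A>0 B B>0 ε
      (f m (⊔ˡ {K} {L} m₁)) (g n (⊔ʳ {K} {L} n₁))
      (h m n (⊔ˡ {M} {N} m₂) (⊔ˡ {M} {N} n₂))
      (k m n (⊔ʳ {M} {N} m₂) (⊔ʳ {M} {N} n₂))

fromℚʳ : ℚ → ℝ
seq    (fromℚʳ q) _ = q
cauchy (fromℚʳ q)   = const-cauchy q

infixl 6 _+ʳ_
infixl 7 _*ʳ_
infix  8 -ʳ_

_+ʳ_ : ℝ → ℝ → ℝ
seq    (x +ʳ y) n = seq x n ℚ.+ seq y n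
cauchy (x +ʳ y)   = add-cauchy (seq x) (seq y) (cauchy x) (cauchy y)

_*ʳ_ : ℝ → ℝ → ℝ
seq    (x *ʳ y) n = seq x n ℚ.* seq y n
cauchy (x *ʳ y)   = mul-cauchy (seq x) (seq y) (cauchy x) (cauchy y)

-ʳ_ : ℝ → ℝ
seq    (-ʳ x) n = ℚ.- seq x n
cauchy (-ʳ x)   = neg-cauchy (seq x) (cauchy x)

pointwise : ∀ {x y} → (∀ n → seq x n ≡ seq y n) → x ≈ʳ y
pointwise {x} {y} e = mk≈ʳ λ ε p → 0 , λ n _ →
  subst (ℚ._< ε) (sym (trans (cong (λ t → ∣ t ℚ.- seq y n ∣) (e n)) (self-diff (seq y n))))
    (ℚ.positive⁻¹ ε {{p}})

private
  ≈ʳ-sym : ∀ {x y} → x ≈ʳ y → y ≈ʳ x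
  ≈ʳ-sym {x} {y} e = mk≈ʳ λ ε p → let N , f = close e ε p in N , λ n h →
    subst (ℚ._< ε) (diff-sym (seq x n) (seq y n)) (f n h)

  ≈ʳ-trans : ∀ {x y z} → x ≈ʳ y → y ≈ʳ z → x ≈ʳ z
  ≈ʳ-trans {x} {y} {z} e e′ = mk≈ʳ λ ε p →
    let M , f = close e  (½ ℚ.* ε) (half-pos ε p)
        N , g = close e′ (½ ℚ.* ε) (half-pos ε p)
    in M ℕ.⊔ N , λ n h →
      tri<ε (seq x n) (seq y n) (seq z n) ε (f n (⊔ˡ h)) (g n (⊔ʳ {M} h))

  +ʳ-cong : ∀ {x x′ y y′} → x ≈ʳ x′ → y ≈ʳ y′ → x +ʳ y ≈ʳ x′ +ʳ y′
  +ʳ-cong {x} {x′} {y} {y′} e e′ = mk≈ʳ λ ε p →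
    let M , f = close e  (½ ℚ.* ε) (half-pos ε p)
        N , g = close e′ (½ ℚ.* ε) (half-pos ε p)
    in M ℕ.⊔ N , λ n h →
      add<ε (seq x n) (seq y n) (seq x′ n) (seq y′ n) ε (f n (⊔ˡ h)) (g n (⊔ʳ {M} h))

  -ʳ-cong : ∀ {x y} → x ≈ʳ y → -ʳ x ≈ʳ -ʳ y
  -ʳ-cong {x} {y} e = mk≈ʳ λ ε p → let N , f = close e ε p in N , λ n h →
    subst (ℚ._< ε) (sym (neg-diff (seq x n) (seq y n))) (f n h)

  *ʳ-cong : ∀ {x x′ y y′} → x ≈ʳ x′ → y ≈ʳ y′ → x *ʳ y ≈ʳ x′ *ʳ y′
  *ʳ-cong {x} {x′} {y} {y′} e e′ = mk≈ʳ λ ε p →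
    let A , K , A>0 , f = bounded (seq x) (cauchy x)
        B , L , B>0 , g = bounded (seq y′) (cauchy y′)
        M , h = close e′ (scale A A>0 ε) (scale-pos A A>0 ε p)
        N , k = close e  (scale B B>0 ε) (scale-pos B B>0 ε p)
    in (K ℕ.⊔ L) ℕ.⊔ (M ℕ.⊔ N) , λ n hn →
      let n₁ = ⊔ˡ {K ℕ.⊔ L} {M ℕ.⊔ N} hn
          n₂ = ⊔ʳ {K ℕ.⊔ L} {M ℕ.⊔ N} hn
      in mul<ε (seq x n) (seq y n) (seq x′ n) (seq y′ n) A A>0 B B>0 ε
        (f n (⊔ˡ {K} {L} n₁)) (g n (⊔ʳ {K} {L} n₁))
        (h n (⊔ˡ {M} {N} n₂)) (k n (⊔ʳ {M} {N} n₂))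

ℝ-commutativeRing : CommutativeRing 0ℓ 0ℓ
ℝ-commutativeRing = record
  { Carrier = ℝ
  ; _≈_ = _≈ʳ_
  ; _+_ = _+ʳ_
  ; _*_ = _*ʳ_
  ; -_  = -ʳ_
  ; 0#  = fromℚʳ 0ℚ
  ; 1#  = fromℚʳ 1ℚ
  ; isCommutativeRing = record
    { isRing = record
      { +-isAbelianGroup = record
        { isGroup = record
          { isMonoid = record
            { isSemigroup = record
              { isMagma = record
                { isEquivalence = record
                  { refl  = pointwise λ _ → refl
                  ; sym   = ≈ʳ-sym
                  ; trans = ≈ʳ-trans
                  }
                ; ∙-cong = +ʳ-cong
                }
              ; assoc = λ x y z → pointwise λ n → ℚ.+-assoc (seq x n) (seq y n) (seq z n)
              }
            ; identity = (λ x → pointwise λ n → ℚ.+-identityˡ (seq x n))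
                       , (λ x → pointwise λ n → ℚ.+-identityʳ (seq x n))
            }
          ; inverse = (λ x → pointwise λ n → ℚ.+-inverseˡ (seq x n))
                    , (λ x → pointwise λ n → ℚ.+-inverseʳ (seq x n))
          ; ⁻¹-cong = -ʳ-cong
          }
        ; comm = λ x y → pointwise λ n → ℚ.+-comm (seq x n) (seq y n)
        }
      ; *-cong = *ʳ-cong
      ; *-assoc = λ x y z → pointwise λ n → ℚ.*-assoc (seq x n) (seq y n) (seq z n)
      ; *-identity = (λ x → pointwise λ n → ℚ.*-identityˡ (seq x n))
                   , (λ x → pointwise λ n → ℚ.*-identityʳ (seq x n))
      ; distrib = (λ x y z → pointwise λ n → ℚ.*-distribˡ-+ (seq x n) (seq y n) (seq z n))
                , (λ x y z → pointwise λ n → ℚ.*-distribʳ-+ (seq x n) (seq y n) (seq z n))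
      }
    ; *-comm = λ x y → pointwise λ n → ℚ.*-comm (seq x n) (seq y n)
    }
  }

------------------------------------------------------------------------
-- Complex numbers: a + b i is represented by the pair of its real and
-- imaginary parts.

record ℂ : Set where
  no-eta-equality
  field
    re im : ℝ

open ℂ public

infix 4 _≈_

record _≈_ (z w : ℂ) : Set where
  constructor mk≈
  field
    re≈ : re z ≈ʳ re w
    im≈ : im z ≈ʳ im w

open _≈_ public

infixl 6 _+_ _-_
infixl 7 _*_
infix  8 -_

_+_ : ℂ → ℂ → ℂ
re (z + w) = re z +ʳ re w
im (z + w) = im z +ʳ im w

_*_ : ℂ → ℂ → ℂ
re (z * w) = re z *ʳ re w +ʳ -ʳ (im z *ʳ im w)
im (z * w) = re z *ʳ im w +ʳ im z *ʳ re w

-_ : ℂ → ℂ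
re (- z) = -ʳ re z
im (- z) = -ʳ im z

_-_ : ℂ → ℂ → ℂ
z - w = z + (- w)

fromℚ : ℚ → ℂ
re (fromℚ q) = fromℚʳ q
im (fromℚ q) = fromℚʳ 0ℚ

fromℤ : ℤ → ℂ
fromℤ a = fromℚ (a ℚ./ 1)

private
  module ℝ-Ring = CommutativeRing ℝ-commutativeRing
  module ℝ-Laws = Laws ℝ-commutativeRing

  *-comm : ∀ x y → x * y ≈ y * x
  *-comm x y = mk≈ (ℝ-Laws.comm-re (re x) (im x) (re y) (im y)) (ℝ-Laws.comm-im (re x) (im x) (re y) (im y))

  ≈-trans : ∀ {x y z} → x ≈ y → y ≈ z → x ≈ z
  ≈-trans (mk≈ p q) (mk≈ r s) = mk≈ (ℝ-Ring.trans p r) (ℝ-Ring.trans q s)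

  +-cong : ∀ {x x′ y y′} → x ≈ x′ → y ≈ y′ → x + y ≈ x′ + y′
  +-cong (mk≈ p q) (mk≈ r s) = mk≈ (ℝ-Ring.+-cong p r) (ℝ-Ring.+-cong q s)

  *-cong : ∀ {x x′ y y′} → x ≈ x′ → y ≈ y′ → x * y ≈ x′ * y′
  *-cong (mk≈ p q) (mk≈ r s) = mk≈
    (ℝ-Ring.+-cong (ℝ-Ring.*-cong p r) (ℝ-Ring.-‿cong (ℝ-Ring.*-cong q s)))
    (ℝ-Ring.+-cong (ℝ-Ring.*-cong p s) (ℝ-Ring.*-cong q r))

  *-identityˡ : ∀ x → fromℚ 1ℚ * x ≈ x
  *-identityˡ x = mk≈ (ℝ-Laws.identity-re (re x) (im x)) (ℝ-Laws.identity-im (re x) (im x))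

  *-distribˡ : ∀ x y z → x * (y + z) ≈ x * y + x * z
  *-distribˡ x y z =
    mk≈ (ℝ-Laws.distrib-re (re x) (im x) (re y) (im y) (re z) (im z))
        (ℝ-Laws.distrib-im (re x) (im x) (re y) (im y) (re z) (im z))

ℂ-commutativeRing : CommutativeRing 0ℓ 0ℓ
ℂ-commutativeRing = record
  { Carrier = ℂ
  ; _≈_ = _≈_
  ; _+_ = _+_
  ; _*_ = _*_
  ; -_  = -_
  ; 0#  = fromℚ 0ℚ
  ; 1#  = fromℚ 1ℚ
  ; isCommutativeRing = record
    { isRing = record
      { +-isAbelianGroup = record
        { isGroup = record
          { isMonoid = record
            { isSemigroup = record
              { isMagma = record
                { isEquivalence = record
                  { refl  = mk≈ ℝ-Ring.refl ℝ-Ring.refl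
                  ; sym   = λ (mk≈ p q) → mk≈ (ℝ-Ring.sym p) (ℝ-Ring.sym q)
                  ; trans = ≈-trans
                  }
                ; ∙-cong = +-cong
                }
              ; assoc = λ x y z → mk≈ (ℝ-Ring.+-assoc (re x) (re y) (re z))
                                      (ℝ-Ring.+-assoc (im x) (im y) (im z))
              }
            ; identity = (λ x → mk≈ (ℝ-Ring.+-identityˡ (re x)) (ℝ-Ring.+-identityˡ (im x)))
                       , (λ x → mk≈ (ℝ-Ring.+-identityʳ (re x)) (ℝ-Ring.+-identityʳ (im x)))
            }
          ; inverse = (λ x → mk≈ (ℝ-Ring.-‿inverseˡ (re x)) (ℝ-Ring.-‿inverseˡ (im x)))
                    , (λ x → mk≈ (ℝ-Ring.-‿inverseʳ (re x)) (ℝ-Ring.-‿inverseʳ (im x)))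
          ; ⁻¹-cong = λ (mk≈ p q) → mk≈ (ℝ-Ring.-‿cong p) (ℝ-Ring.-‿cong q)
          }
        ; comm = λ x y → mk≈ (ℝ-Ring.+-comm (re x) (re y)) (ℝ-Ring.+-comm (im x) (im y))
        }
      ; *-cong = *-cong
      ; *-assoc = λ x y z →
          mk≈ (ℝ-Laws.assoc-re (re x) (im x) (re y) (im y) (re z) (im z))
        (ℝ-Laws.assoc-im (re x) (im x) (re y) (im y) (re z) (im z))
      ; *-identity = *-identityˡ
                   , (λ z → ≈-trans (*-comm z (fromℚ 1ℚ)) (*-identityˡ z))
      ; distrib = *-distribˡ
                , (λ x y z → ≈-trans (*-comm (y + z) x)
                    (≈-trans (*-distribˡ x y z) (+-cong (*-comm x y) (*-comm x z))))
      }
    ; *-comm = *-comm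
    }
  }

-- ∑[ k < n ] f k  sums f over k : Fin n, i.e. over 0 ≤ k ≤ n - 1.
open import Algebra.Properties.Monoid.Sum (CommutativeRing.+-monoid ℂ-commutativeRing) public
  using (sum; sum-syntax)

IsGeneralizedFibonacci : (ℤ → ℂ) → Set
IsGeneralizedFibonacci G = ∀ (m : ℤ) → G (m ℤ.+ + 2) ≈ G (m ℤ.+ + 1) + G m

{-# OPTIONS --safe #-}
-- Since G satisfies the Fibonacci recurrence, the convolution
-- A n = ∑ F k G (n - k) satisfies
--   A (n + 2) = A (n + 1) + A n + F (n + 2) G 0 + F (n + 1) (G 1 - G 0)
-- for every F.  For F k = k² G k, the right-hand side of the theorem obeys
-- the same recurrence: this is a polynomial identity in n, G n, G (n + 1),
-- G 0 and G 1.  Both sides agree at n = 0 and n = 1.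
module Submission where

open import Algebra.Bundles using (CommutativeRing)
open import Algebra.Morphism.Structures using (module RingMorphisms)
open import Algebra.Solver.Ring.AlmostCommutativeRing
  using (fromCommutativeRing; _-Raw-AlmostCommutative⟶_)
open import Data.Fin.Base using (toℕ)
open import Data.Fin.Patterns using (0F)
open import Data.Fin.Properties using (toℕ≤pred[n])
open import Data.Integer.Base as ℤ using (ℤ; +_)
import Data.Integer.Properties as ℤ
open import Data.Maybe.Base using (Maybe; just; nothing)
open import Data.Nat.Base as ℕ using (ℕ; zero; suc; _∸_)
import Data.Nat.Properties as ℕ
open import Data.Rational.Base as ℚ using ()
import Data.Rational.Properties as ℚ
open import Data.Rational.Unnormalised.Base as ℚᵘ using (mkℚᵘ)
import Data.Rational.Unnormalised.Properties as ℚᵘ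
open import Data.Vec.Base using (Vec; []; _∷_; lookup; map)
open import Data.Vec.Properties using (lookup-map)
open import Relation.Binary.PropositionalEquality as ≡ using (_≡_)
open import Relation.Nullary.Decidable using (yes; no)

-- Fibonacci convolutions over a commutative ring.

module _ {c ℓ} (R : CommutativeRing c ℓ) where
  private
    module R = CommutativeRing R
  open RingMorphisms ℤ.+-*-rawRing R.rawRing using (IsRingHomomorphism)

  -- Only ring laws and a homomorphism from ℤ enter, so the ring stays abstract. It need not contain
  -- 1/150: the identity is proved multiplied by `φ (+ 150)`.
  module FibonacciConvolution (φ : ℤ → R.Carrier) (φ-hom : IsRingHomomorphism φ)
    (g : ℕ → R.Carrier) (g-rec : ∀ n → g (2 ℕ.+ n) R.≈ g (1 ℕ.+ n) R.+ g n) where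

    open R
    open IsRingHomomorphism φ-hom
    open import Algebra.Properties.Monoid.Sum +-monoid using (sum-syntax)
    open import Relation.Binary.Reasoning.Setoid setoid

    private
      φ-morphism : ℤ.+-*-rawRing -Raw-AlmostCommutative⟶ fromCommutativeRing R
      φ-morphism = record
        { ⟦_⟧    = φ
        ; +-homo = +-homo
        ; *-homo = *-homo
        ; -‿homo = -‿homo
        ; 0-homo = 0#-homo
        ; 1-homo = 1#-homo
        }

      φ-≟ : ∀ i j → Maybe (φ i ≈ φ j)
      φ-≟ i j with i ℤ.≟ j
      ... | yes i≡j = just (⟦⟧-cong i≡j)
      ... | no  _   = nothing

    open import Algebra.Solver.Ring
      ℤ.+-*-rawRing (fromCommutativeRing R) φ-morphism φ-≟
    open import Algebra.Properties.Semiring.Exp semiring using (_^_; ^-congˡ)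

    -- The solver treats φ of a composite integer expression as opaque; evalℤ-homo
    -- turns the coefficients φ (…) of the theorem into polynomials in φ (+ n).
    evalℤ : ∀ {m} → Polynomial m → Vec ℤ m → ℤ
    evalℤ (op [+] p q) ρ = evalℤ p ρ ℤ.+ evalℤ q ρ
    evalℤ (op [*] p q) ρ = evalℤ p ρ ℤ.* evalℤ q ρ
    evalℤ (con i)      ρ = i
    evalℤ (var x)      ρ = lookup ρ x
    evalℤ (p :^ k)     ρ = evalℤ p ρ ℤ.^ k
    evalℤ (:- p)       ρ = ℤ.- evalℤ p ρ

    ^-homo : ∀ i k → φ (i ℤ.^ k) ≈ φ i ^ k
    ^-homo i zero    = 1#-homo
    ^-homo i (suc k) = trans (*-homo i (i ℤ.^ k)) (*-congˡ (^-homo i k))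

    evalℤ-homo : ∀ {m} (p : Polynomial m) ρ → φ (evalℤ p ρ) ≈ ⟦ p ⟧ (map φ ρ)
    evalℤ-homo (op [+] p q) ρ =
      trans (+-homo (evalℤ p ρ) (evalℤ q ρ)) (+-cong (evalℤ-homo p ρ) (evalℤ-homo q ρ))
    evalℤ-homo (op [*] p q) ρ =
      trans (*-homo (evalℤ p ρ) (evalℤ q ρ)) (*-cong (evalℤ-homo p ρ) (evalℤ-homo q ρ))
    evalℤ-homo (con i)      ρ = refl
    evalℤ-homo (var x)      ρ = reflexive (≡.sym (lookup-map x φ ρ))
    evalℤ-homo (p :^ k)     ρ = trans (^-homo (evalℤ p ρ) k) (^-congˡ k (evalℤ-homo p ρ))
    evalℤ-homo (:- p)       ρ = trans (-‿homo (evalℤ p ρ)) (-‿cong (evalℤ-homo p ρ))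

    conv : (ℕ → Carrier) → ℕ → Carrier
    conv f n = ∑[ k < suc n ] (f (toℕ k) * g (n ∸ toℕ k))

    -- The recurrence of `g` splits every term with `k ≤ n`; the two terms beyond leave `g 0` and
    -- `g 1 - g 0`, the latter playing the part of `g` at -1. `f` is arbitrary because the induction
    -- passes to its shift `f′`.
    conv-rec : ∀ f n → conv f (2 ℕ.+ n) ≈
      conv f (1 ℕ.+ n) + conv f n + (f (2 ℕ.+ n) * g 0 + f (1 ℕ.+ n) * (g 1 - g 0))
    conv-rec f zero = begin
      conv f 2
        ≈⟨ +-congʳ (*-congˡ (g-rec 0)) ⟩
      f 0 * (g 1 + g 0) + (f 1 * g 1 + (f 2 * g 0 + 0#))
        -- The empty sum ends in `0#`; written as `φ ℤ.0ℤ` it is a coefficient for the solver.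
        ≈⟨ +-congˡ (+-congˡ (+-congˡ 0#-homo)) ⟨
      f 0 * (g 1 + g 0) + (f 1 * g 1 + (f 2 * g 0 + φ ℤ.0ℤ))
        ≈⟨ solve 5 (λ u v w x y →
             u :* (y :+ x) :+ (v :* y :+ (w :* x :+ con ℤ.0ℤ)) :=
             (u :* y :+ (v :* x :+ con ℤ.0ℤ)) :+ (u :* x :+ con ℤ.0ℤ) :+
             (w :* x :+ v :* (y :- x))) refl (f 0) (f 1) (f 2) (g 0) (g 1) ⟩
      (f 0 * g 1 + (f 1 * g 0 + φ ℤ.0ℤ)) + (f 0 * g 0 + φ ℤ.0ℤ) + last
        ≈⟨ +-congʳ (+-cong (+-congˡ (+-congˡ 0#-homo)) (+-congˡ 0#-homo)) ⟩
      conv f 1 + conv f 0 + last ∎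
      where last = f 2 * g 0 + f 1 * (g 1 - g 0)
    conv-rec f (suc n) = begin
      -- Splitting off the term `k = 0` is definitional.
      f 0 * g (3 ℕ.+ n) + conv f′ (2 ℕ.+ n)
        ≈⟨ +-cong (*-congˡ (g-rec (suc n))) (conv-rec f′ n) ⟩
      f 0 * (g (2 ℕ.+ n) + g (1 ℕ.+ n)) + (conv f′ (1 ℕ.+ n) + conv f′ n + last)
        ≈⟨ solve 6 (λ u x y p q r →
             u :* (y :+ x) :+ (p :+ q :+ r) := (u :* y :+ p) :+ (u :* x :+ q) :+ r)
             refl (f 0) (g (1 ℕ.+ n)) (g (2 ℕ.+ n)) (conv f′ (1 ℕ.+ n)) (conv f′ n) last ⟩
      conv f (2 ℕ.+ n) + conv f (1 ℕ.+ n) + last ∎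
      where
      f′ : ℕ → Carrier
      f′ k = f (suc k)
      last = f (3 ℕ.+ n) * g 0 + f (2 ℕ.+ n) * (g 1 - g 0)

    -- The closed form and its recurrence.

    module _ {m} (n : Polynomial m) where
      -- Kept as syntax for two uses: `evalℤ` computes them to the integer coefficients of the
      -- theorem, and `bracketₚ` hands them to the solver.
      coeff₁ coeff₂ coeff₃ coeff₄ : Polynomial m
      coeff₁ = con (+ 3) :* n :* (con (+ 10) :* n :^ 2 :+ con (+ 25) :* n :+ con (+ 13))
      coeff₂ = (n :+ con (+ 1)) :* (con (+ 10) :* n :^ 2 :+ con (+ 5) :* n :- con (+ 12))
      coeff₃ = (n :- con (+ 1)) :* (con (+ 10) :* n :^ 2 :- con (+ 5) :* n :- con (+ 12))
      coeff₄ = con (+ 2) :* n :* (con (+ 10) :* n :^ 2 :- con (+ 7))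

      bracketₚ : (a b x y : Polynomial m) → Polynomial m
      bracketₚ a b x y =
        (coeff₁ :* a :- coeff₂ :* b) :* x :- (coeff₃ :* a :- coeff₄ :* b) :* y

    bracket : ℤ → (x y : Carrier) → Carrier
    bracket i x y =
      (φ (evalℤ (coeff₁ (con i)) []) * g 0 - φ (evalℤ (coeff₂ (con i)) []) * g 1) * x -
      (φ (evalℤ (coeff₃ (con i)) []) * g 0 - φ (evalℤ (coeff₄ (con i)) []) * g 1) * y

    bracket-cong : ∀ i {x x′ y y′} → x ≈ x′ → y ≈ y′ → bracket i x y ≈ bracket i x′ y′
    bracket-cong i p q = +-cong (*-congˡ p) (-‿cong (*-congˡ q))

    -- Evaluating `coeff₁ (con (evalℤ p ρ))` at `[]` and `coeff₁ p` at `ρ` gives the same integer by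
    -- computation, so `evalℤ-homo` applies to `coeff₁ p`; likewise for the others.
    bracket-eval : ∀ {m} (p : Polynomial m) (ρ : Vec ℤ m) (x y : Carrier) →
      let σ = map φ ρ in
      bracket (evalℤ p ρ) x y ≈
      (⟦ coeff₁ p ⟧ σ * g 0 - ⟦ coeff₂ p ⟧ σ * g 1) * x -
      (⟦ coeff₃ p ⟧ σ * g 0 - ⟦ coeff₄ p ⟧ σ * g 1) * y
    bracket-eval p ρ x y = +-cong
      (*-congʳ (+-cong (*-congʳ (evalℤ-homo (coeff₁ p) ρ))
                       (-‿cong (*-congʳ (evalℤ-homo (coeff₂ p) ρ)))))
      (-‿cong (*-congʳ (+-cong (*-congʳ (evalℤ-homo (coeff₃ p) ρ))
                               (-‿cong (*-congʳ (evalℤ-homo (coeff₄ p) ρ))))))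

    weighted : ℕ → Carrier
    weighted k = φ ((+ k) ℤ.^ 2) * g k

    -- With `y + x` and `y + x + y` in place of the next two values of `g`, the Fibonacci recurrence
    -- is already substituted, and the rest is a polynomial identity in five independent variables.
    bracket-rec : ∀ n → let N = + n; x = g n; y = g (1 ℕ.+ n) in
      bracket (+ 2 ℤ.+ N) (y + x) (y + x + y) ≈
      bracket (+ 1 ℤ.+ N) y (y + x) + bracket N x y +
      φ (+ 150) * (φ ((+ 2 ℤ.+ N) ℤ.^ 2) * (y + x) * g 0 +
                   φ ((+ 1 ℤ.+ N) ℤ.^ 2) * y * (g 1 - g 0))
    bracket-rec n = begin
      bracket (+ 2 ℤ.+ N) (y + x) (y + x + y)
        ≈⟨ bracket-eval (con (+ 2) :+ v) ρ (y + x) (y + x + y) ⟩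
      _
        ≈⟨ solve 5 (λ ν a b x y →
             bracketₚ (con (+ 2) :+ ν) a b (y :+ x) (y :+ x :+ y) :=
             bracketₚ (con (+ 1) :+ ν) a b y (y :+ x) :+ bracketₚ ν a b x y :+
             con (+ 150) :* ((con (+ 2) :+ ν) :^ 2 :* (y :+ x) :* a :+
                             (con (+ 1) :+ ν) :^ 2 :* y :* (b :- a)))
             refl (φ N) (g 0) (g 1) x y ⟩
      _
        ≈⟨ +-cong
             (+-cong (bracket-eval (con (+ 1) :+ v) ρ y (y + x)) (bracket-eval v ρ x y))
             (*-congˡ (+-cong
               (*-congʳ (*-congʳ (evalℤ-homo ((con (+ 2) :+ v) :^ 2) ρ)))
               (*-congʳ (*-congʳ (evalℤ-homo ((con (+ 1) :+ v) :^ 2) ρ))))) ⟨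
      _ ∎
      where
      N = + n
      x = g n
      y = g (1 ℕ.+ n)
      v : Polynomial 1
      v = var 0F
      ρ = N ∷ []

    conv-weighted : ∀ n → φ (+ 150) * conv weighted n ≈ bracket (+ n) (g n) (g (1 ℕ.+ n))
    conv-weighted zero = begin
      φ (+ 150) * (φ (+ 0) * g 0 * g 0 + 0#)
        ≈⟨ *-congˡ (+-congˡ 0#-homo) ⟨
      φ (+ 150) * (φ (+ 0) * g 0 * g 0 + φ (+ 0))
        ≈⟨ solve 2 (λ a b →
             con (+ 150) :* (con (+ 0) :* a :* a :+ con (+ 0)) :=
             bracketₚ (con (+ 0)) a b a b) refl (g 0) (g 1) ⟩
      _
        ≈⟨ bracket-eval (con (+ 0)) [] (g 0) (g 1) ⟨
      bracket (+ 0) (g 0) (g 1) ∎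
    conv-weighted (suc zero) = begin
      φ (+ 150) * (φ (+ 0) * g 0 * g 1 + (φ (+ 1) * g 1 * g 0 + 0#))
        ≈⟨ *-congˡ (+-congˡ (+-congˡ 0#-homo)) ⟨
      φ (+ 150) * (φ (+ 0) * g 0 * g 1 + (φ (+ 1) * g 1 * g 0 + φ (+ 0)))
        ≈⟨ solve 2 (λ a b →
             con (+ 150) :* (con (+ 0) :* a :* b :+ (con (+ 1) :* b :* a :+ con (+ 0))) :=
             bracketₚ (con (+ 1)) a b b (b :+ a)) refl (g 0) (g 1) ⟩
      _
        ≈⟨ bracket-eval (con (+ 1)) [] (g 1) (g 1 + g 0) ⟨
      bracket (+ 1) (g 1) (g 1 + g 0)
        ≈⟨ bracket-cong (+ 1) refl (g-rec 0) ⟨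
      bracket (+ 1) (g 1) (g 2) ∎
    conv-weighted (suc (suc n)) = begin
      d * conv weighted (2 ℕ.+ n)
        ≈⟨ *-congˡ (conv-rec weighted n) ⟩
      d * (conv weighted (1 ℕ.+ n) + conv weighted n +
           (weighted (2 ℕ.+ n) * g 0 + weighted (1 ℕ.+ n) * (g 1 - g 0)))
        ≈⟨ trans (distribˡ d _ _) (+-congʳ (distribˡ d _ _)) ⟩
      d * conv weighted (1 ℕ.+ n) + d * conv weighted n +
      d * (weighted (2 ℕ.+ n) * g 0 + weighted (1 ℕ.+ n) * (g 1 - g 0))
        -- `g (2 ℕ.+ n)` is expanded everywhere, also inside `weighted (2 ℕ.+ n)`, to match
        -- `bracket-rec`.
        ≈⟨ +-cong
             (+-cong (trans (conv-weighted (suc n)) (bracket-cong (+ suc n) refl (g-rec n)))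
                     (conv-weighted n))
             (*-congˡ (+-congʳ (*-congʳ (*-congˡ (g-rec n))))) ⟩
      _
        ≈⟨ bracket-rec n ⟨
      bracket (+ (2 ℕ.+ n)) (g (1 ℕ.+ n) + g n) (g (1 ℕ.+ n) + g n + g (1 ℕ.+ n))
        ≈⟨ bracket-cong (+ (2 ℕ.+ n)) (g-rec n)
             (trans (g-rec (suc n)) (+-congʳ (g-rec n))) ⟨
      bracket (+ (2 ℕ.+ n)) (g (2 ℕ.+ n)) (g (3 ℕ.+ n)) ∎
      where d = φ (+ 150)

-- The ring homomorphism from ℤ to ℂ.

-- fromℚᵘ (mkℚᵘ i 0) unfolds to i ℚ./ 1.
toℚᵘ-/1 : ∀ i → ℚ.toℚᵘ (i ℚ./ 1) ℚᵘ.≃ mkℚᵘ i 0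
toℚᵘ-/1 i = ℚ.toℚᵘ-fromℚᵘ (mkℚᵘ i 0)

-- `i ℚ./ 1` is normalised by a gcd that is stuck for variable `i`; on unnormalised fractions the
-- denominators simply stay 1.
/1-homo-+ : ∀ i j → (i ℤ.+ j) ℚ./ 1 ≡ (i ℚ./ 1) ℚ.+ (j ℚ./ 1)
/1-homo-+ i j = ℚ.toℚᵘ-injective (begin
  ℚ.toℚᵘ ((i ℤ.+ j) ℚ./ 1)                 ≈⟨ toℚᵘ-/1 (i ℤ.+ j) ⟩
  -- Unnormalised addition cross-multiplies, giving the numerator `i ℤ.* 1 + j ℤ.* 1`.
  mkℚᵘ (i ℤ.+ j) 0                         ≡⟨ ≡.cong (λ k → mkℚᵘ k 0)
                                                 (≡.cong₂ ℤ._+_ (ℤ.*-identityʳ i) (ℤ.*-identityʳ j)) ⟨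
  mkℚᵘ i 0 ℚᵘ.+ mkℚᵘ j 0                   ≈⟨ ℚᵘ.+-cong (toℚᵘ-/1 i) (toℚᵘ-/1 j) ⟨
  ℚ.toℚᵘ (i ℚ./ 1) ℚᵘ.+ ℚ.toℚᵘ (j ℚ./ 1)   ≈⟨ ℚ.toℚᵘ-homo-+ (i ℚ./ 1) (j ℚ./ 1) ⟨
  ℚ.toℚᵘ ((i ℚ./ 1) ℚ.+ (j ℚ./ 1))         ∎)
  where open import Relation.Binary.Reasoning.Setoid ℚᵘ.≃-setoid

/1-homo-* : ∀ i j → (i ℤ.* j) ℚ./ 1 ≡ (i ℚ./ 1) ℚ.* (j ℚ./ 1)
/1-homo-* i j = ℚ.toℚᵘ-injective (begin
  ℚ.toℚᵘ ((i ℤ.* j) ℚ./ 1)                 ≈⟨ toℚᵘ-/1 (i ℤ.* j) ⟩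
  mkℚᵘ i 0 ℚᵘ.* mkℚᵘ j 0                   ≈⟨ ℚᵘ.*-cong (toℚᵘ-/1 i) (toℚᵘ-/1 j) ⟨
  ℚ.toℚᵘ (i ℚ./ 1) ℚᵘ.* ℚ.toℚᵘ (j ℚ./ 1)   ≈⟨ ℚ.toℚᵘ-homo-* (i ℚ./ 1) (j ℚ./ 1) ⟨
  ℚ.toℚᵘ ((i ℚ./ 1) ℚ.* (j ℚ./ 1))         ∎)
  where open import Relation.Binary.Reasoning.Setoid ℚᵘ.≃-setoid

/1-homo-neg : ∀ i → (ℤ.- i) ℚ./ 1 ≡ ℚ.- (i ℚ./ 1)
/1-homo-neg i = ℚ.toℚᵘ-injective (begin
  ℚ.toℚᵘ ((ℤ.- i) ℚ./ 1)     ≈⟨ toℚᵘ-/1 (ℤ.- i) ⟩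
  ℚᵘ.- mkℚᵘ i 0              ≈⟨ ℚᵘ.-‿cong (toℚᵘ-/1 i) ⟨
  ℚᵘ.- ℚ.toℚᵘ (i ℚ./ 1)      ≈⟨ ℚ.toℚᵘ-homo‿- (i ℚ./ 1) ⟨
  ℚ.toℚᵘ (ℚ.- (i ℚ./ 1))     ∎)
  where open import Relation.Binary.Reasoning.Setoid ℚᵘ.≃-setoid

open import Defs

private
  module C = CommutativeRing ℂ-commutativeRing

-- Values of `fromℤ` have constant sequences as parts, so equality in ℚ at each index suffices.
fromℤ-homo-+ : ∀ i j → fromℤ (i ℤ.+ j) ≈ fromℤ i + fromℤ j
fromℤ-homo-+ i j = mk≈ (pointwise λ _ → /1-homo-+ i j) (pointwise λ _ → ≡.refl)

fromℤ-homo-* : ∀ i j → fromℤ (i ℤ.* j) ≈ fromℤ i * fromℤ j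
fromℤ-homo-* i j = mk≈
  -- The product of the imaginary parts evaluates to zero, leaving `+ 0` to remove.
  (pointwise λ _ → ≡.trans (/1-homo-* i j) (≡.sym (ℚ.+-identityʳ ((i ℚ./ 1) ℚ.* (j ℚ./ 1)))))
  (pointwise λ _ → ≡.sym (≡.cong₂ ℚ._+_ (ℚ.*-zeroʳ (i ℚ./ 1)) (ℚ.*-zeroˡ (j ℚ./ 1))))

fromℤ-homo-neg : ∀ i → fromℤ (ℤ.- i) ≈ - fromℤ i
fromℤ-homo-neg i = mk≈ (pointwise λ _ → /1-homo-neg i) (pointwise λ _ → ≡.refl)

fromℤ-isRingHomomorphism :
  RingMorphisms.IsRingHomomorphism ℤ.+-*-rawRing C.rawRing fromℤ
fromℤ-isRingHomomorphism = record
  { isSemiringHomomorphism = record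
    { isNearSemiringHomomorphism = record
      { +-isMonoidHomomorphism = record
        { isMagmaHomomorphism = record
          { isRelHomomorphism = record { cong = λ { ≡.refl → C.refl } }
          ; homo = fromℤ-homo-+
          }
        ; ε-homo = C.refl
        }
      ; *-homo = fromℤ-homo-*
      }
    ; 1#-homo = C.refl
    }
  ; -‿homo = fromℤ-homo-neg
  }

-- Transfer to complex sequences indexed by ℤ.

m-n≡m∸n : ∀ {m n} → n ℕ.≤ m → + m ℤ.- + n ≡ + (m ∸ n)
m-n≡m∸n {m} {n} n≤m = ≡.trans (ℤ.m-n≡m⊖n m n) (ℤ.⊖-≥ n≤m)

1/150*150≈1 : fromℚ (+ 1 ℚ./ 150) * fromℤ (+ 150) ≈ fromℚ ℚ.1ℚ
1/150*150≈1 = mk≈ (pointwise λ _ → ≡.refl) (pointwise λ _ → ≡.refl)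

mainTheorem11 : (G : ℤ → ℂ) → IsGeneralizedFibonacci G → (n : ℕ) →
    let N = + n in
    ∑[ k < suc n ] (fromℤ ((+ toℕ k) ℤ.^ 2) * G (+ toℕ k) * G (N ℤ.- + toℕ k))
    ≈
    fromℚ (+ 1 ℚ./ 150) *
      ( ( fromℤ (+ 3 ℤ.* N ℤ.* (+ 10 ℤ.* N ℤ.^ 2 ℤ.+ + 25 ℤ.* N ℤ.+ + 13)) * G (+ 0)
        - fromℤ ((N ℤ.+ + 1) ℤ.* (+ 10 ℤ.* N ℤ.^ 2 ℤ.+ + 5 ℤ.* N ℤ.- + 12)) * G (+ 1) ) * G N
      - ( fromℤ ((N ℤ.- + 1) ℤ.* (+ 10 ℤ.* N ℤ.^ 2 ℤ.- + 5 ℤ.* N ℤ.- + 12)) * G (+ 0)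
        - fromℤ (+ 2 ℤ.* N ℤ.* (+ 10 ℤ.* N ℤ.^ 2 ℤ.- + 7)) * G (+ 1) ) * G (N ℤ.+ + 1) )
mainTheorem11 G G-rec n = begin
  _
    -- An index in `Fin (suc n)` is at most `n`, so truncated and integer subtraction agree.
    ≈⟨ sum-cong-≋ {suc n} (λ k → C.*-congˡ {weighted (toℕ k)} (G-cong (m-n≡m∸n (toℕ≤pred[n] k)))) ⟩
  S
    ≈⟨ C.*-identityˡ S ⟨
  fromℚ ℚ.1ℚ * S
    ≈⟨ C.*-congʳ 1/150*150≈1 ⟨
  fromℚ (+ 1 ℚ./ 150) * fromℤ (+ 150) * S
    ≈⟨ C.*-assoc (fromℚ (+ 1 ℚ./ 150)) (fromℤ (+ 150)) S ⟩
  fromℚ (+ 1 ℚ./ 150) * (fromℤ (+ 150) * S)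
    ≈⟨ C.*-congˡ (conv-weighted n) ⟩
  fromℚ (+ 1 ℚ./ 150) * bracket (+ n) (G (+ n)) (G (+ suc n))
    -- Only the order of `1 + n` differs from the theorem; the coefficients agree by computation.
    ≈⟨ C.*-congˡ (bracket-cong (+ n) C.refl (G-cong (≡.cong +_ (ℕ.+-comm 1 n)))) ⟩
  fromℚ (+ 1 ℚ./ 150) * bracket (+ n) (G (+ n)) (G (+ n ℤ.+ + 1)) ∎
  where
  open import Relation.Binary.Reasoning.Setoid C.setoid
  open import Algebra.Properties.Monoid.Sum C.+-monoid using (sum-cong-≋)

  G-cong : ∀ {i j} → i ≡ j → G i ≈ G j
  G-cong ≡.refl = C.refl

  g : ℕ → ℂ
  g k = G (+ k)

  g-rec : ∀ k → g (2 ℕ.+ k) ≈ g (1 ℕ.+ k) + g k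
  g-rec k = C.trans (G-cong (≡.cong +_ (ℕ.+-comm 2 k)))
    (C.trans (G-rec (+ k)) (C.+-congʳ (G-cong (≡.cong +_ (ℕ.+-comm k 1)))))

  open FibonacciConvolution ℂ-commutativeRing fromℤ fromℤ-isRingHomomorphism g g-rec

  S : ℂ
  S = conv weighted n
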